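{- Let $k\ge 2$ be an integer and let $\mathcal{P}_k=(p_i)_{i=0}^\infty$ be the pattern sequence over $\mathbb{F}_2$ associated with the all-one pattern of length $k$. For every integer $N\ge 2^{k+3}-7$, the $N$th maximum order complexity of $\mathcal{P}_k$ satisfies $$M(\mathcal{P}_k,N)=(2^{k-1}-1)\,2^\ell+1,\qquad\text{where}\qquad \ell=\left\lceil \frac{\log \bigl(N/(2^k-1)\bigr)}{\log 2}\right\rceil-1 .$$
   Context: For a positive integer $k$, the pattern sequence $\mathcal{P}_k=(p_i)_{i=0}^\infty$ over the two-element field $\mathbb{F}_2$ is defined by $p_0=0$ and, for $i=1,2,\ldots$, $p_i=p_{\lfloor i/2\rfloor}+1$ if $i\equiv -1 \bmod 2^k$ and $p_i=p_{\lfloor i/2\rfloor}$ otherwise (equivalently, $p_i$ is the parity of the number of, possibly overlapping, occurrences of the all-one pattern of length $k$ in the binary expansion of $i$). For $k=2$ this is the Rudin-Shapiro sequence. For a binary sequence $\mathcal{S}=(s_i)_{i=0}^\infty$ over $\mathbb{F}_2$ and a positive integer $N$, the $N$th maximum order complexity $M(\mathcal{S},N)$ is defined as follows. If $(s_0,\ldots,s_{N-2})$ is not a constant tuple $(a,\ldots,a)$ with $a\in\{0,1\}$, then $M(\mathcal{S},N)$ is the smallest positive integer $M$ such that there is a polynomial $f(x_1,\ldots,x_M)\in\mathbb{F}_2[x_1,\ldots,x_M]$ with $$s_{i+M}=f(s_i,s_{i+1},\ldots,s_{i+M-1}),\quad 0\le i\le N-M-1.$$ If $s_i=a$ for all $i=0,\ldots,N-2$,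 then $M(\mathcal{S},N)=0$ if $s_{N-1}=a$ and $M(\mathcal{S},N)=N-1$ if $s_{N-1}\ne a$. -}

module Defs where

open import Data.Nat.Base
  using (ℕ; zero; suc; _+_; _*_; _∸_; _^_; _≤_; _<_; z≤n; s≤s; pred; NonZero; NonTrivial; ⌊_/2⌋; ⌈_/2⌉; >-nonZero)
import Data.Nat.Properties as ℕ
open import Data.Nat.Divisibility using (_∣_; _∣?_)
open import Data.Nat.Induction using (<-wellFounded)
import Data.Nat.Logarithm as Log
open import Data.Integer.Base as ℤ using (+_; -[1+_])
import Data.Integer.Properties as ℤ
import Data.Integer.DivMod as ℤ
open import Data.Rational.Unnormalised.Base as ℚᵘ using (ℚᵘ; mkℚᵘ; ↥_; ↧_)
open import Data.Parity.Base as 𝔽₂ using (Parity; 0ℙ; 1ℙ)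
open import Data.Fin.Base using (Fin; toℕ)
open import Data.List.Base using (List; foldr)
open import Data.Vec.Base using (Vec; zipWith; tabulate)
import Data.Vec.Base as Vec
open import Data.Product using (∃; ∃-syntax; _×_; _,_)
open import Data.Empty using (⊥-elim)
open import Function.Bundles using (_⇔_; mk⇔)
open import Induction.WellFounded using (Acc; acc)
open import Relation.Nullary using (¬_; yes; no; contradiction)
open import Relation.Binary.PropositionalEquality
  using (_≡_; _≢_; refl; sym; trans; cong; subst; subst₂)

-- The two-element field 𝔽₂ is `Parity` and a binary sequence is a
-- function ℕ → Parity.

-- A polynomial in m variables over 𝔽₂ is a finite formal sum of terms
-- c · x₁^e₁ ⋯ xₘ^eₘ, each given by its coefficient and exponent vector.

Poly : ℕ → Set
Poly m = List (Parity × Vec ℕ m)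

infixr 8 _^ℙ_

_^ℙ_ : Parity → ℕ → Parity
x ^ℙ zero  = 1ℙ
x ^ℙ suc e = x 𝔽₂.* (x ^ℙ e)

evalTerm : ∀ {m} → Parity × Vec ℕ m → Vec Parity m → Parity
evalTerm (c , es) xs = c 𝔽₂.* Vec.foldr _ 𝔽₂._*_ 1ℙ (zipWith _^ℙ_ xs es)

eval : ∀ {m} → Poly m → Vec Parity m → Parity
eval f xs = foldr (λ t r → evalTerm t xs 𝔽₂.+ r) 0ℙ f

window : (ℕ → Parity) → ℕ → (M : ℕ) → Vec Parity M
window s i M = tabulate λ (j : Fin M) → s (i + toℕ j)

-- `i + M < N` is 0 ≤ i ≤ N - M - 1 without truncated subtraction.

HasRecurrence : (ℕ → Parity) → (N M : ℕ) → Set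
HasRecurrence s N M =
  ∃[ f ] (∀ i → i + M < N → s (i + M) ≡ eval {M} f (window s i M))

ConstantUpTo : (ℕ → Parity) → ℕ → Parity → Set
ConstantUpTo s n a = ∀ i → i < n → s i ≡ a

-- The graph of (S , N) ↦ M(S , N), meant for N ≥ 1; it is functional
-- by `M-unique` below.

data MaximumOrderComplexity (s : ℕ → Parity) (N : ℕ) : ℕ → Set where
  nonconstant : ∀ {M} →
    ¬ (∃[ a ] ConstantUpTo s (pred N) a) →
    1 ≤ M →
    HasRecurrence s N M →
    (∀ M′ → 1 ≤ M′ → HasRecurrence s N M′ → M ≤ M′) →
    MaximumOrderComplexity s N M
  constant-≡ : ∀ a →
    ConstantUpTo s (pred N) a → s (pred N) ≡ a →
    MaximumOrderComplexity s N 0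
  constant-≢ : ∀ a →
    ConstantUpTo s (pred N) a → s (pred N) ≢ a →
    MaximumOrderComplexity s N (pred N)

private
  ≡≢⇒pred≡0 : ∀ s n {a b} → ConstantUpTo s n a → s n ≡ a →
              ConstantUpTo s n b → s n ≢ b → 0 ≡ n
  ≡≢⇒pred≡0 s zero    ca ea cb nb = refl
  ≡≢⇒pred≡0 s (suc n) ca ea cb nb =
    ⊥-elim (nb (trans ea (trans (sym (ca 0 (s≤s z≤n))) (cb 0 (s≤s z≤n)))))

M-unique : ∀ {s N M M′} →
           MaximumOrderComplexity s N M → MaximumOrderComplexity s N M′ → M ≡ M′
M-unique (nonconstant _ p r l) (nonconstant _ p′ r′ l′) =
  ℕ.≤-antisym (l _ p′ r′) (l′ _ p r)
M-unique (nonconstant n _ _ _) (constant-≡ a c _) = contradiction (a , c) n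
M-unique (nonconstant n _ _ _) (constant-≢ a c _) = contradiction (a , c) n
M-unique (constant-≡ a c _) (nonconstant n _ _ _) = contradiction (a , c) n
M-unique (constant-≢ a c _) (nonconstant n _ _ _) = contradiction (a , c) n
M-unique (constant-≡ _ _ _) (constant-≡ _ _ _) = refl
M-unique (constant-≢ _ _ _) (constant-≢ _ _ _) = refl
M-unique {s} {N} (constant-≡ _ c e) (constant-≢ _ c′ n) = ≡≢⇒pred≡0 s (pred N) c e c′ n
M-unique {s} {N} (constant-≢ _ c′ n) (constant-≡ _ c e) = sym (≡≢⇒pred≡0 s (pred N) c e c′ n)

-- i ≡ -1 mod 2^k is expressed as 2^k ∣ i + 1.

increment : ℕ → ℕ → Parity
increment k i with 2 ^ k ∣? suc i
... | yes _ = 1ℙ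
... | no  _ = 0ℙ

patternAcc : ℕ → (i : ℕ) → Acc _<_ i → Parity
patternAcc k zero    _        = 0ℙ
patternAcc k (suc i) (acc rs) =
  patternAcc k ⌊ suc i /2⌋ (rs (ℕ.⌊n/2⌋<n i)) 𝔽₂.+ increment k (suc i)

pattern-sequence : ℕ → ℕ → Parity
pattern-sequence k i = patternAcc k i (<-wellFounded i)

private
  patternAcc-irr : ∀ k i (p q : Acc _<_ i) → patternAcc k i p ≡ patternAcc k i q
  patternAcc-irr k zero    _        _        = refl
  patternAcc-irr k (suc i) (acc rs) (acc qs) =
    cong (𝔽₂._+ increment k (suc i)) (patternAcc-irr k ⌊ suc i /2⌋ _ _)

  unfold : ∀ k i → pattern-sequence k (suc i) ≡
           pattern-sequence k ⌊ suc i /2⌋ 𝔽₂.+ increment k (suc i)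
  unfold k i with <-wellFounded (suc i)
  ... | acc rs = cong (𝔽₂._+ increment k (suc i)) (patternAcc-irr k ⌊ suc i /2⌋ _ _)

  +-0ℙ : ∀ x → x 𝔽₂.+ 0ℙ ≡ x
  +-0ℙ 0ℙ = refl
  +-0ℙ 1ℙ = refl

  increment-yes : ∀ k i → 2 ^ k ∣ suc i → increment k i ≡ 1ℙ
  increment-yes k i d with 2 ^ k ∣? suc i
  ... | yes _ = refl
  ... | no ¬d = contradiction d ¬d

  increment-no : ∀ k i → ¬ 2 ^ k ∣ suc i → increment k i ≡ 0ℙ
  increment-no k i ¬d with 2 ^ k ∣? suc i
  ... | yes d = contradiction d ¬d
  ... | no _  = refl

pattern-zero : ∀ k → pattern-sequence k 0 ≡ 0ℙ
pattern-zero k = refl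

pattern-step : ∀ k i → 1 ≤ i → 2 ^ k ∣ suc i →
               pattern-sequence k i ≡ pattern-sequence k ⌊ i /2⌋ 𝔽₂.+ 1ℙ
pattern-step k (suc i) _ d =
  trans (unfold k i) (cong (pattern-sequence k ⌊ suc i /2⌋ 𝔽₂.+_) (increment-yes k (suc i) d))

pattern-stay : ∀ k i → 1 ≤ i → ¬ 2 ^ k ∣ suc i →
               pattern-sequence k i ≡ pattern-sequence k ⌊ i /2⌋
pattern-stay k (suc i) _ ¬d =
  trans (unfold k i) (trans (cong (pattern-sequence k ⌊ suc i /2⌋ 𝔽₂.+_) (increment-no k (suc i) ¬d)) (+-0ℙ (pattern-sequence k ⌊ suc i /2⌋)))

-- The ceiling of the base-2 logarithm of a rational number q ≥ 1
-- (for 0 < q < 1 the value is 0 rather than a non-positive integer).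
-- `⌈log₂⌉≤⇔≤2^` is the defining property of ⌈ log q / log 2 ⌉ as the
-- least n with log q / log 2 ≤ n, i.e. with q ≤ 2^n.

⌈log₂_⌉ : ℚᵘ → ℕ
⌈log₂ q ⌉ = Log.⌈log₂ ℤ.∣ ℚᵘ.ceiling q ∣ ⌉

private
  ceiling≤⇒ : ∀ q z → ℚᵘ.ceiling q ℤ.≤ z → ↥ q ℤ.≤ z ℤ.* ↧ q
  ceiling≤⇒ q@(mkℚᵘ n d) z c≤z = subst₂ ℤ._≤_ (ℤ.neg-involutive n) eq (ℤ.neg-mono-≤ le)
    where
    f = ℚᵘ.floor (ℚᵘ.- q)
    -z≤f : ℤ.- z ℤ.≤ f
    -z≤f = subst (ℤ.- z ℤ.≤_) (ℤ.neg-involutive f) (ℤ.neg-mono-≤ c≤z)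
    le : ℤ.- z ℤ.* ↧ q ℤ.≤ ℤ.- n
    le = ℤ.≤-trans (ℤ.*-monoʳ-≤-nonNeg (↧ q) -z≤f) (ℤ.[n/d]*d≤n (ℤ.- n) (↧ q))
    eq : ℤ.- (ℤ.- z ℤ.* ↧ q) ≡ z ℤ.* ↧ q
    eq = trans (ℤ.neg-distribˡ-* (ℤ.- z) (↧ q)) (cong (ℤ._* ↧ q) (ℤ.neg-involutive z))

  ceiling≤⇐ : ∀ q z → ↥ q ℤ.≤ z ℤ.* ↧ q → ℚᵘ.ceiling q ℤ.≤ z
  ceiling≤⇐ q@(mkℚᵘ n d) z n≤zd = subst (ℤ.- f ℤ.≤_) (ℤ.neg-involutive z) (ℤ.neg-mono-≤ -z≤f)
    where
    a = ℤ.- n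
    f = a ℤ./ ↧ q
    a<[1+f]d : a ℤ.< (+ 1 ℤ.+ f) ℤ.* ↧ q
    a<[1+f]d = subst₂ ℤ._<_ (sym (ℤ.a≡a%n+[a/n]*n a (↧ q)))
      (sym (trans (ℤ.*-distribʳ-+ (↧ q) (+ 1) f) (cong (ℤ._+ f ℤ.* ↧ q) (ℤ.*-identityˡ (↧ q)))))
      (ℤ.+-monoˡ-< (f ℤ.* ↧ q) (ℤ.+<+ (ℤ.n%d<d a (↧ q))))
    -zd≤a : ℤ.- z ℤ.* ↧ q ℤ.≤ a
    -zd≤a = subst (ℤ._≤ a) (ℤ.neg-distribˡ-* z (↧ q)) (ℤ.neg-mono-≤ n≤zd)
    -z<1+f : ℤ.- z ℤ.< ℤ.suc f
    -z<1+f = ℤ.*-cancelʳ-<-nonNeg (↧ q) (ℤ.≤-<-trans -zd≤a a<[1+f]d)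
    -z≤f : ℤ.- z ℤ.≤ f
    -z≤f = subst₂ ℤ._≤_ (ℤ.pred-suc (ℤ.- z)) (ℤ.pred-suc f)
      (ℤ.+-monoʳ-≤ (ℤ.- + 1) (ℤ.i<j⇒suc[i]≤j -z<1+f))

  n≤2*⌈n/2⌉ : ∀ n → n ≤ 2 * ⌈ n /2⌉
  n≤2*⌈n/2⌉ n = subst₂ _≤_ (ℕ.⌊n/2⌋+⌈n/2⌉≡n n)
    (cong (λ x → ⌈ n /2⌉ + x) (sym (ℕ.+-identityʳ ⌈ n /2⌉))) (ℕ.+-monoˡ-≤ ⌈ n /2⌉ (ℕ.⌊n/2⌋≤⌈n/2⌉ n))

  log≤⇒≤2^ : ∀ m n → Log.⌈log₂ n ⌉ ≤ m → n ≤ 2 ^ m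
  log≤⇒≤2^ m 0 _ = z≤n
  log≤⇒≤2^ m 1 _ = ℕ.m^n>0 2 m
  log≤⇒≤2^ (suc m) n@(suc (suc _)) p = ℕ.≤-trans (n≤2*⌈n/2⌉ n)
    (ℕ.*-monoʳ-≤ 2 (log≤⇒≤2^ m ⌈ n /2⌉
      (subst (_≤ m) (sym (Log.⌈log₂⌈n/2⌉⌉≡⌈log₂n⌉∸1 n)) (ℕ.∸-monoˡ-≤ 1 p))))

  ≤2^⇒log≤ : ∀ m n → n ≤ 2 ^ m → Log.⌈log₂ n ⌉ ≤ m
  ≤2^⇒log≤ m n p = subst (Log.⌈log₂ n ⌉ ≤_) (Log.⌈log₂2^n⌉≡n m) (Log.⌈log₂⌉-mono-≤ p)

  0≤ceiling : ∀ q .{{_ : ℚᵘ.Positive q}} → + 0 ℤ.≤ ℚᵘ.ceiling q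
  0≤ceiling q@(mkℚᵘ (+ suc n) d) with ℚᵘ.ceiling q | ceiling≤⇒ q (ℚᵘ.ceiling q) ℤ.≤-refl
  ... | + _      | _ = ℤ.+≤+ z≤n
  ... | -[1+ _ ] | ()

⌈log₂⌉≤⇔≤2^ : ∀ q .{{_ : ℚᵘ.Positive q}} n →
               ⌈log₂ q ⌉ ≤ n ⇔ q ℚᵘ.≤ (+ (2 ^ n) ℚᵘ./ 1)
⌈log₂⌉≤⇔≤2^ q n = mk⇔ to from
  where
  ∣c∣ = ℤ.0≤i⇒+∣i∣≡i (0≤ceiling q)
  to : ⌈log₂ q ⌉ ≤ n → q ℚᵘ.≤ (+ (2 ^ n) ℚᵘ./ 1)
  to p = ℚᵘ.*≤* (subst (ℤ._≤ + (2 ^ n) ℤ.* ↧ q) (sym (ℤ.*-identityʳ (↥ q)))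
    (ceiling≤⇒ q (+ (2 ^ n)) (subst (ℤ._≤ + (2 ^ n)) ∣c∣ (ℤ.+≤+ (log≤⇒≤2^ n _ p)))))
  from : q ℚᵘ.≤ (+ (2 ^ n) ℚᵘ./ 1) → ⌈log₂ q ⌉ ≤ n
  from (ℚᵘ.*≤* le) = ≤2^⇒log≤ n _ (ℤ.drop‿+≤+ (subst (ℤ._≤ + (2 ^ n)) (sym ∣c∣)
    (ceiling≤⇐ q (+ (2 ^ n)) (subst (ℤ._≤ + (2 ^ n) ℤ.* ↧ q) (ℤ.*-identityʳ (↥ q)) le))))

instance
  2^k∸1-nonZero : ∀ {k} .{{_ : NonTrivial k}} → NonZero (2 ^ k ∸ 1)
  2^k∸1-nonZero {suc (suc k)} =
    >-nonZero (ℕ.∸-monoˡ-≤ {2} 1 (ℕ.*-monoʳ-≤ 2 (ℕ.m^n>0 2 (suc k))))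

{-# OPTIONS --safe #-}
-- Write D = 2^(k-1) and L = (D - 1) 2^ℓ, so that
-- (2D - 1) 2^ℓ < N ≤ (2D - 1) 2^(ℓ+1).  Two windows are compatible when they
-- differ or have the same successor; a recurrence of order M exists iff any
-- two windows of length M are compatible.
--
-- Lower bound: p(t + D 2^ℓ) = p(t) for t < L, but not for t = L.
--
-- Upper bound: p(2u) = p(u), and p(2u+1) = p(u) + 1 exactly when D ∣ u + 1.
-- If equal windows of length 2L + 1 start at indices i ≡ j mod D, comparing
-- the entries at 2u and 2u+1 yields i ≡ j mod 2D.  The successor is then
-- immediate for even i, and for odd i it is the successor of windows of
-- length L + 1 at ⌊i/2⌋ ≡ ⌊j/2⌋ mod D.  The descent ends at ℓ = 0, where the
-- only 1 in range is p(2D - 1).  For ℓ ≥ 3 equal parity of i and j suffices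
-- to start, as the windows are long enough to give i ≡ j mod 2D at once, and
-- opposite parities would give a function of least period 2D the period D.
module Submission where

open import Defs
open import Data.Nat.Base hiding (_/_)
open import Data.Nat.Properties
open import Data.Nat.Divisibility
open import Data.Nat.Induction using (<-rec)
open import Data.Nat.Tactic.RingSolver using (solve-∀)
import Data.Integer.Base as ℤ
import Data.Integer.Properties as ℤ
open import Data.Rational.Unnormalised.Base as ℚᵘ using (_/_)
open import Data.Fin.Base using (toℕ; fromℕ<)
open import Data.Fin.Properties using (toℕ-fromℕ<; toℕ<n)
open import Data.List.Base using ([]; _∷_; _++_; map)
open import Data.Vec.Base using (Vec; []; _∷_; lookup)
open import Data.Vec.Properties using (≡-dec; lookup∘tabulate; tabulate-cong)
open import Data.Parity.Base as 𝔽₂ using (Parity; 0ℙ; 1ℙ)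
import Data.Parity.Properties as 𝔽₂
open import Data.Product using (∃-syntax; _×_; _,_; map₂)
open import Function.Bundles using (module Equivalence)
open import Relation.Nullary using (¬_; yes; no; contradiction)
open import Relation.Binary.PropositionalEquality hiding ([_])

-- Recurrences as compatibility of equal windows

Agree : (ℕ → Parity) → ℕ → ℕ → ℕ → Set
Agree s M i j = ∀ t → t < M → s (i + t) ≡ s (j + t)

Predicts : (ℕ → Parity) → (N M i j : ℕ) → Set
Predicts s N M i j = i + M < N → j + M < N → Agree s M i j → s (i + M) ≡ s (j + M)

eval-++ : ∀ {m} (f g : Poly m) xs → eval (f ++ g) xs ≡ eval f xs 𝔽₂.+ eval g xs
eval-++ []      g xs = refl
eval-++ (t ∷ f) g xs = trans (cong (evalTerm t xs 𝔽₂.+_) (eval-++ f g xs))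
  (sym (𝔽₂.+-assoc (evalTerm t xs) (eval f xs) (eval g xs)))

infixr 7 x^_·_

x^_·_ : ∀ {m} → ℕ → Poly m → Poly (suc m)
x^ e · f = map (map₂ (e ∷_)) f

eval-x^· : ∀ {m} e (f : Poly m) x xs → eval (x^ e · f) (x ∷ xs) ≡ x ^ℙ e 𝔽₂.* eval f xs
eval-x^· e []            x xs = sym (𝔽₂.*-zeroʳ (x ^ℙ e))
eval-x^· e ((c , es) ∷ f) x xs = trans (cong₂ 𝔽₂._+_ (swap c (x ^ℙ e) _) (eval-x^· e f x xs))
  (sym (𝔽₂.*-distribˡ-+ (x ^ℙ e) (evalTerm (c , es) xs) (eval f xs)))
  where
  swap : ∀ a b c → a 𝔽₂.* (b 𝔽₂.* c) ≡ b 𝔽₂.* (a 𝔽₂.* c)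
  swap a b c = trans (sym (𝔽₂.*-assoc a b c)) (trans (cong (𝔽₂._* c) (𝔽₂.*-comm a b)) (𝔽₂.*-assoc b a c))

-- g(x, xs) = g(0, xs) + x (g(0, xs) + g(1, xs)) over 𝔽₂.
interpolate : ∀ m → (Vec Parity m → Parity) → Poly m
interpolate zero    g = (g [] , []) ∷ []
interpolate (suc m) g = (x^ 0 · interpolate m λ xs → g (0ℙ ∷ xs))
                     ++ (x^ 1 · interpolate m λ xs → g (0ℙ ∷ xs) 𝔽₂.+ g (1ℙ ∷ xs))

eval-interpolate : ∀ m g xs → eval (interpolate m g) xs ≡ g xs
eval-interpolate zero    g [] = trans (𝔽₂.+-identityʳ _) (𝔽₂.*-identityʳ (g []))
eval-interpolate (suc m) g (x ∷ xs) = begin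
  eval (interpolate (suc m) g) (x ∷ xs)
    ≡⟨ eval-++ (x^ 0 · interpolate m _) (x^ 1 · interpolate m _) (x ∷ xs) ⟩
  eval (x^ 0 · interpolate m _) (x ∷ xs) 𝔽₂.+ eval (x^ 1 · interpolate m _) (x ∷ xs)
    ≡⟨ cong₂ 𝔽₂._+_ (eval-x^· 0 (interpolate m _) x xs) (eval-x^· 1 (interpolate m _) x xs) ⟩
  eval (interpolate m _) xs 𝔽₂.+ (x ^ℙ 1 𝔽₂.* eval (interpolate m _) xs)
    ≡⟨ cong₂ (λ a b → a 𝔽₂.+ (x ^ℙ 1 𝔽₂.* b)) (eval-interpolate m _ xs) (eval-interpolate m _ xs) ⟩
  g (0ℙ ∷ xs) 𝔽₂.+ (x ^ℙ 1 𝔽₂.* (g (0ℙ ∷ xs) 𝔽₂.+ g (1ℙ ∷ xs)))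
    ≡⟨ combine x ⟩
  g (x ∷ xs) ∎
  where
  open ≡-Reasoning
  combine : ∀ x → g (0ℙ ∷ xs) 𝔽₂.+ (x ^ℙ 1 𝔽₂.* (g (0ℙ ∷ xs) 𝔽₂.+ g (1ℙ ∷ xs))) ≡ g (x ∷ xs)
  combine 0ℙ = 𝔽₂.+-identityʳ (g (0ℙ ∷ xs))
  combine 1ℙ = trans (sym (𝔽₂.+-assoc (g (0ℙ ∷ xs)) _ _)) (cong (𝔽₂._+ g (1ℙ ∷ xs)) (𝔽₂.p+p≡0ℙ (g (0ℙ ∷ xs))))

window-cong : ∀ s {M i j} → Agree s M i j → window s i M ≡ window s j M
window-cong s agree = tabulate-cong λ t → agree (toℕ t) (toℕ<n t)

window-agree : ∀ s {M i j} → window s i M ≡ window s j M → Agree s M i j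
window-agree s {M} {i} {j} eq t t<M = begin
  s (i + t)                        ≡⟨ at i ⟨
  lookup (window s i M) (fromℕ< t<M)  ≡⟨ cong (λ w → lookup w (fromℕ< t<M)) eq ⟩
  lookup (window s j M) (fromℕ< t<M)  ≡⟨ at j ⟩
  s (j + t)                        ∎
  where
  open ≡-Reasoning
  at : ∀ i → lookup (window s i M) (fromℕ< t<M) ≡ s (i + t)
  at i = trans (lookup∘tabulate _ (fromℕ< t<M)) (cong (λ x → s (i + x)) (toℕ-fromℕ< t<M))

successor : (s : ℕ → Parity) (M n : ℕ) → Vec Parity M → Parity
-- Default for vectors that match no window; `successor-correct` never reaches it.
successor s M zero    xs = 0ℙ
successor s M (suc n) xs with ≡-dec 𝔽₂._≟_ (window s n M) xs
... | yes _ = s (n + M)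
... | no _  = successor s M n xs

-- The search may stop at a later window equal to the one at `i`; compatibility makes the two
-- successors equal.
successor-correct : ∀ {s N M} → (∀ i j → Predicts s N M i j) → ∀ n → n + M ≤ N →
                    ∀ i → i < n → s (i + M) ≡ successor s M n (window s i M)
successor-correct {s} {N} {M} predicts (suc n) n< i i≤n
  with ≡-dec 𝔽₂._≟_ (window s n M) (window s i M)
... | yes eq = predicts i n (≤-<-trans (+-monoˡ-≤ M (s≤s⁻¹ i≤n)) n<) n< (window-agree s (sym eq))
... | no neq = successor-correct predicts n (<⇒≤ n<) i
  (≤∧≢⇒< (s≤s⁻¹ i≤n) λ { refl → neq refl })

predicts⇒HasRecurrence : ∀ s {N M} → (∀ i j → Predicts s N M i j) → HasRecurrence s N M
predicts⇒HasRecurrence s {N} {M} predicts = interpolate M g , λ i i+M<N →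
  trans (successor-correct predicts n (n+M≤N i i+M<N) i (m+n≤o⇒m≤o∸n (suc i) i+M<N))
        (sym (eval-interpolate M g (window s i M)))
  where
  n = N ∸ M
  g = successor s M n
  -- Truncated subtraction breaks this bound when M > N; an admissible `i` supplies M ≤ N.
  n+M≤N : ∀ i → i + M < N → n + M ≤ N
  n+M≤N i i+M<N = ≤-reflexive (m∸n+n≡m (≤-trans (m≤n+m M i) (<⇒≤ i+M<N)))

HasRecurrence⇒predicts : ∀ s {N M} → HasRecurrence s N M → ∀ i j → Predicts s N M i j
HasRecurrence⇒predicts s (f , rec) i j i< j< agree =
  trans (rec i i<) (trans (cong (eval f) (window-cong s agree)) (sym (rec j j<)))

-- Parity, divisibility and congruence

data EvenOdd : ℕ → Set where
  even : ∀ u → EvenOdd (2 * u)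
  odd  : ∀ u → EvenOdd (suc (2 * u))

even-or-odd : ∀ n → EvenOdd n
even-or-odd zero = even 0
even-or-odd (suc n) with even-or-odd n
... | even u = odd u
... | odd u  = subst EvenOdd (eq u) (even (suc u))
  where
  eq : ∀ u → 2 * suc u ≡ suc (suc (2 * u))
  eq = solve-∀

2∣⇒half : ∀ {n} → 2 ∣ n → ∃[ u ] n ≡ 2 * u
2∣⇒half (divides q eq) = q , trans eq (*-comm q 2)

-- As `n` grows by one the complement drops by one, wrapping from 0 to d - 1. It later supplies
-- window offsets with a prescribed divisibility.
∃-complement : ∀ d .{{_ : NonZero d}} n → ∃[ x ] x < d × d ∣ n + x
∃-complement d zero = 0 , >-nonZero⁻¹ d , d ∣0
∃-complement d@(suc e) (suc n) with ∃-complement d n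
... | zero , _ , d∣n = e , n<1+n e , subst (d ∣_) (eq n e) (∣m∣n⇒∣m+n d∣n ∣-refl)
  where
  eq : ∀ n e → (n + 0) + suc e ≡ suc n + e
  eq = solve-∀
... | suc x , x<d , d∣n+x = x , <-trans (n<1+n x) x<d , subst (d ∣_) (+-suc n x) d∣n+x

∣∧<2*⇒≡ : ∀ {d n} .{{_ : NonZero n}} → d ∣ n → n < 2 * d → n ≡ d
∣∧<2*⇒≡ {d} (divides 1 refl) _ = *-identityˡ d
∣∧<2*⇒≡ {d} (divides (suc (suc q)) refl) n<2d =
  contradiction (*-monoˡ-≤ d {2} {suc (suc q)} (s≤s (s≤s z≤n))) (<⇒≱ n<2d)

-- i ≡ j mod d, stated with a common complement so as to avoid subtraction.
Congruent : ℕ → ℕ → ℕ → Set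
Congruent d i j = ∃[ x ] d ∣ i + x × d ∣ j + x

Congruent-sym : ∀ {d i j} → Congruent d i j → Congruent d j i
Congruent-sym (x , p , q) = x , q , p

-- Since (i + y) + (j + x) = (i + x) + (j + y) and `d` divides three of the four brackets, it
-- divides the fourth.
Congruent-transfer : ∀ {d i j} → Congruent d i j → ∀ {y} → d ∣ i + y → d ∣ j + y
Congruent-transfer {d} {i} {j} (x , d∣i+x , d∣j+x) {y} d∣i+y =
  ∣m+n∣m⇒∣n (subst (d ∣_) (eq i j x y) (∣m∣n⇒∣m+n d∣i+y d∣j+x)) d∣i+x
  where
  eq : ∀ i j x y → (i + y) + (j + x) ≡ (i + x) + (j + y)
  eq = solve-∀

Congruent-∣ : ∀ {c d i j} → c ∣ d → Congruent d i j → Congruent c i j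
Congruent-∣ c∣d (x , p , q) = x , ∣-trans c∣d p , ∣-trans c∣d q

¬Congruent-even-odd : ∀ u v → ¬ Congruent 2 (2 * u) (suc (2 * v))
¬Congruent-even-odd u v c
  with a , eq ← 2∣⇒half (Congruent-transfer c {0} (subst (2 ∣_) (sym (+-identityʳ (2 * u))) (m∣m*n u)))
  = even≢odd a v (trans (sym eq) (+-identityʳ _))

-- `x` must be even, since 2 divides both 2u + x and 2u; the factor 2 then cancels throughout.
Congruent-half-even : ∀ {d u v} → Congruent (2 * d) (2 * u) (2 * v) → Congruent d u v
Congruent-half-even {d} {u} {v} (x , p , q) with even-or-odd x
... | even y = y , *-cancelˡ-∣ 2 (subst (2 * d ∣_) (sym (*-distribˡ-+ 2 u y)) p)
                 , *-cancelˡ-∣ 2 (subst (2 * d ∣_) (sym (*-distribˡ-+ 2 v y)) q)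
... | odd y with a , eq ← 2∣⇒half (∣-trans (m∣m*n {2} d) p)
  = contradiction (trans (sym eq) (lemma u y)) (even≢odd a (u + y))
  where
  lemma : ∀ u y → 2 * u + suc (2 * y) ≡ suc (2 * (u + y))
  lemma = solve-∀

Congruent-half-odd : ∀ {d u v} → Congruent (2 * d) (suc (2 * u)) (suc (2 * v)) → Congruent d u v
Congruent-half-odd {d} {u} {v} (x , p , q) =
  Congruent-half-even (suc x , subst (2 * d ∣_) (sym (+-suc _ x)) p , subst (2 * d ∣_) (sym (+-suc _ x)) q)

∤2*⇒∣+ : ∀ {d n} → d ∣ n → ¬ 2 * d ∣ n → 2 * d ∣ n + d
∤2*⇒∣+ {d} (divides q refl) ∤ with even-or-odd q
... | even r = contradiction (divides r (eq r d)) ∤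
  where
  eq : ∀ r d → 2 * r * d ≡ r * (2 * d)
  eq = solve-∀
... | odd r = divides (suc r) (eq r d)
  where
  eq : ∀ r d → suc (2 * r) * d + d ≡ suc r * (2 * d)
  eq = solve-∀

∣2*⇒∤+ : ∀ {d n} .{{_ : NonZero d}} → 2 * d ∣ n → ¬ 2 * d ∣ n + d
∣2*⇒∤+ {d} 2d∣n 2d∣n+d = <⇒≱ (m<m+n d (subst (0 <_) (sym (+-identityʳ d)) (>-nonZero⁻¹ d))) (∣⇒≤ (∣m+n∣m⇒∣n 2d∣n+d 2d∣n))

indicator : ℕ → ℕ → Parity
indicator d n with d ∣? n
... | yes _ = 1ℙ
... | no  _ = 0ℙ

indicator-∣ : ∀ {d n} → d ∣ n → indicator d n ≡ 1ℙ
indicator-∣ {d} {n} d∣n with d ∣? n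
... | yes _   = refl
... | no d∤n = contradiction d∣n d∤n

indicator-∤ : ∀ {d n} → ¬ d ∣ n → indicator d n ≡ 0ℙ
indicator-∤ {d} {n} d∤n with d ∣? n
... | yes d∣n = contradiction d∣n d∤n
... | no _    = refl

indicator-≡1 : ∀ {d n} → indicator d n ≡ 1ℙ → d ∣ n
indicator-≡1 {d} {n} eq with d ∣? n
... | yes d∣n = d∣n
indicator-≡1 () | no _

indicator-cong : ∀ {d m n} → (d ∣ m → d ∣ n) → (d ∣ n → d ∣ m) → indicator d m ≡ indicator d n
indicator-cong {d} {m} {n} f g with d ∣? m
... | yes d∣m = sym (indicator-∣ (f d∣m))
... | no d∤m  = sym (indicator-∤ (λ d∣n → d∤m (g d∣n)))

indicator-periodic : ∀ d n → indicator d (n + d) ≡ indicator d n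
indicator-periodic d n = indicator-cong
  (λ p → ∣m+n∣m⇒∣n (subst (d ∣_) (+-comm n d) p) ∣-refl) (λ p → ∣m∣n⇒∣m+n p ∣-refl)

indicator-Congruent : ∀ {d i j} n → Congruent d i j → indicator d (i + n) ≡ indicator d (j + n)
indicator-Congruent n c =
  indicator-cong (Congruent-transfer c) (Congruent-transfer (Congruent-sym c))

-- Recovers the bit lost by halving: u + y and v + y are multiples of `d`, and equal indicators make
-- their quotients by `d` both even or both odd. In the odd case y + d serves as the complement.
Congruent-double : ∀ {d u v} y → Congruent d u v → d ∣ u + y →
                   indicator (2 * d) (u + y) ≡ indicator (2 * d) (v + y) →
                   Congruent (2 * d) u v
Congruent-double {d} {u} {v} y c d∣u+y eq with 2 * d ∣? u + y | 2 * d ∣? v + y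
... | yes p | yes q = y , p , q
... | no p  | no q  = y + d , shift u d∣u+y p , shift v (Congruent-transfer c d∣u+y) q
  where
  shift : ∀ u → d ∣ u + y → ¬ 2 * d ∣ u + y → 2 * d ∣ u + (y + d)
  shift u p q = subst (2 * d ∣_) (+-assoc u y d) (∤2*⇒∣+ p q)
Congruent-double y c d∣u+y () | yes p | no q
Congruent-double y c d∣u+y () | no p | yes q

-- Sequences obeying the doubling rules

module DoublingSequence
  (F : ℕ) .{{F≢0 : NonZero F}} (p : ℕ → Parity) (p-zero : p 0 ≡ 0ℙ)
  (p-even : ∀ u → p (2 * u) ≡ p u)
  (p-odd  : ∀ u → p (suc (2 * u)) ≡ p u 𝔽₂.+ indicator (2 * F) (suc u))
  where

  -- For the all-one pattern `F` is 2^(k-2), so `D` is 2^(k-1) and `K` is 2^k - 1, the first index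
  -- where `p` is 1.
  D E K : ℕ
  D = 2 * F
  E = D ∸ 1
  K = 2 * D ∸ 1

  private instance
    D≢0 : NonZero D
    D≢0 = m*n≢0 2 F

  suc-E : suc E ≡ D
  suc-E = m+[n∸m]≡n (>-nonZero⁻¹ D {{D≢0}})

  suc-K : suc K ≡ 2 * D
  suc-K = m+[n∸m]≡n (>-nonZero⁻¹ (2 * D) {{m*n≢0 2 D {{_}} {{D≢0}}}})

  K≡ : K ≡ suc (2 * E)
  K≡ = suc-injective (trans suc-K (trans (cong (2 *_) (sym suc-E)) (eq E)))
    where
    eq : ∀ e → 2 * suc e ≡ suc (suc (2 * e))
    eq = solve-∀

  F≤E : F ≤ E
  F≤E = s≤s⁻¹ (subst (suc F ≤_) (sym suc-E)
    (m<m+n F (subst (0 <_) (sym (+-identityʳ F)) (>-nonZero⁻¹ F))))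

  E<K : E < K
  E<K = subst (E <_) (sym K≡) (s≤s (m≤m+n E _))

  ε : ℕ → Parity
  ε u = indicator D (suc u)

  p-at-even : ∀ {n} u → n ≡ 2 * u → p n ≡ p u
  p-at-even u eq = trans (cong p eq) (p-even u)

  p-at-odd : ∀ {n} u → n ≡ suc (2 * u) → p n ≡ p u 𝔽₂.+ ε u
  p-at-odd u eq = trans (cong p eq) (p-odd u)

  private
    2+2 : ∀ u t → 2 * u + 2 * t ≡ 2 * (u + t)
    2+2 = solve-∀

    2+1+2 : ∀ u t → 2 * u + suc (2 * t) ≡ suc (2 * (u + t))
    2+1+2 = solve-∀

    1+2+2 : ∀ u t → suc (2 * u) + 2 * t ≡ suc (2 * (u + t))
    1+2+2 = solve-∀

    1+2+1+2 : ∀ u t → suc (2 * u) + suc (2 * t) ≡ 2 * (u + suc t)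
    1+2+1+2 = solve-∀

    2+2+2 : ∀ u t → 2 * u + suc (suc (2 * t)) ≡ 2 * (u + suc t)
    2+2+2 = solve-∀

    1+2+2+2 : ∀ u t → suc (2 * u) + suc (suc (2 * t)) ≡ suc (2 * (u + suc t))
    1+2+2+2 = solve-∀

    0-1-2* : ∀ {t L} → t < L → 2 * t < suc (2 * L) × suc (2 * t) < suc (2 * L) × suc (suc (2 * t)) < suc (2 * L)
    0-1-2* {t} {L} t<L = ≤-trans (n≤1+n _) (≤-trans (n≤1+n _) le) , ≤-trans (n≤1+n _) le , le
      where
      eq : ∀ t → 2 * suc t ≡ suc (suc (2 * t))
      eq = solve-∀
      le : suc (suc (suc (2 * t))) ≤ suc (2 * L)
      le = s≤s (subst (_≤ 2 * L) (eq t) (*-monoʳ-≤ 2 t<L))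

  -- Initial values and the case ℓ = 0

  ε≡0 : ∀ {u} → suc u < D → ε u ≡ 0ℙ
  ε≡0 u<D = indicator-∤ λ d → <⇒≱ u<D (∣⇒≤ d)

  -- Halving preserves the bound, and an odd index 2u + 1 < K = 2E + 1 has u + 1 < D, so no
  -- correction is picked up.
  p<K : ∀ n → n < K → p n ≡ 0ℙ
  p<K = <-rec _ step
    where
    step : ∀ n → (∀ {m} → m < n → m < K → p m ≡ 0ℙ) → n < K → p n ≡ 0ℙ
    step n rec n<K with even-or-odd n
    ... | even zero = p-zero
    ... | even u@(suc u′) = trans (p-even u) (rec u<n (<-trans u<n n<K))
      where
      u<n : u < 2 * u
      u<n = m<m+n u (s≤s z≤n)
    ... | odd u = trans (p-odd u) (cong₂ 𝔽₂._+_ (rec u<n (<-trans u<n n<K)) (ε≡0 1+u<D))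
      where
      u<n : u < suc (2 * u)
      u<n = s≤s (m≤m+n u _)
      1+u<D : suc u < D
      1+u<D = subst (suc u <_) suc-E (s≤s (*-cancelˡ-< 2 u E (s≤s⁻¹ (subst (suc (2 * u) <_) K≡ n<K))))

  pK≡1 : p K ≡ 1ℙ
  pK≡1 = trans (p-at-odd E K≡)
    (cong₂ 𝔽₂._+_ (p<K E E<K) (indicator-∣ (subst (D ∣_) (sym suc-E) ∣-refl)))

  -- A correction at 2u + 1 < 2K needs D | u + 1 with u + 1 < 2D, hence u + 1 = D and 2u + 1 = K.
  p<2K : ∀ n → n < 2 * K → n ≢ K → p n ≡ 0ℙ
  p<2K n n<2K n≢K with even-or-odd n
  ... | even u = trans (p-even u) (p<K u (*-cancelˡ-< 2 u K n<2K))
  ... | odd u  = trans (p-odd u) (cong₂ 𝔽₂._+_ (p<K u u<K) (indicator-∤ ∤))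
    where
    u<K : u < K
    u<K = *-cancelˡ-< 2 u K (<-trans (n<1+n _) n<2K)
    ∤ : ¬ D ∣ suc u
    ∤ d = n≢K (trans (cong (λ x → suc (2 * x)) (suc-injective (trans (∣∧<2*⇒≡ d (subst (suc u <_) suc-K (s≤s u<K))) (sym suc-E)))) (sym K≡))

  private
    -- Here i = D - 1, so j + 1 is a multiple of `D` below 3D. Quotient 1 would give j + D = K, and
    -- quotient 2 gives j = K, where p(j) = 1 differs from p(i) = 0 already at offset 0.
    base-mixed : ∀ i j → Congruent D i j → j + D < 2 * K → Agree p D i j →
                 i + D ≡ K → j + D ≢ K → 0ℙ ≡ 1ℙ
    base-mixed i j c j< agree i≡ j≢ = by-quotient (Congruent-transfer c D∣i+1)
      where
      i≡E : i ≡ E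
      i≡E = suc-injective (trans (+-cancelʳ-≡ D (suc i) D
        (trans (cong suc i≡) (trans suc-K (cong (D +_) (+-identityʳ D))))) (sym suc-E))
      D∣i+1 : D ∣ i + 1
      D∣i+1 = ∣-reflexive (sym (trans (+-comm i 1) (trans (cong suc i≡E) suc-E)))
      j+1<3D : j + 1 < 3 * D
      j+1<3D = +-cancelʳ-< D (j + 1) (3 * D) (begin-strict
        j + 1 + D            ≡⟨ eq j D ⟩
        suc (j + D)          <⟨ s≤s j< ⟩
        suc (2 * K)          <⟨ n<1+n _ ⟩
        suc (suc (2 * K))    ≡⟨ eq′ K ⟩
        2 * suc K            ≡⟨ cong (2 *_) suc-K ⟩
        2 * (2 * D)          ≡⟨ eq″ D ⟩
        3 * D + D            ∎)
        where
        open ≤-Reasoning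
        eq : ∀ j d → j + 1 + d ≡ suc (j + d)
        eq = solve-∀
        eq′ : ∀ k → suc (suc (2 * k)) ≡ 2 * suc k
        eq′ = solve-∀
        eq″ : ∀ d → 2 * (2 * d) ≡ 3 * d + d
        eq″ = solve-∀
      by-quotient : D ∣ j + 1 → 0ℙ ≡ 1ℙ
      by-quotient (divides 0 j+1≡) = contradiction (trans (+-comm 1 j) j+1≡) λ ()
      by-quotient (divides 1 j+1≡) = contradiction
        (suc-injective (trans (cong (_+ D) (trans (+-comm 1 j) j+1≡))
          (trans (cong (_+ D) (*-identityˡ D)) (sym (trans suc-K (cong (D +_) (+-identityʳ D)))))))
        j≢
      by-quotient (divides 2 j+1≡) = trans (sym p-i) (trans (agree 0 (>-nonZero⁻¹ D {{D≢0}})) p-j)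
        where
        p-i : p (i + 0) ≡ 0ℙ
        p-i = p<K _ (subst (_< K) (sym (trans (+-identityʳ i) i≡E)) E<K)
        p-j : p (j + 0) ≡ 1ℙ
        p-j = trans (cong p (trans (+-identityʳ j)
          (suc-injective (trans (trans (+-comm 1 j) j+1≡) (sym suc-K))))) pK≡1
      by-quotient (divides (suc (suc (suc q))) j+1≡) = contradiction
        (*-monoˡ-≤ D {3} {3 + q} (s≤s (s≤s (s≤s z≤n)))) (<⇒≱ (subst (_< 3 * D) j+1≡ j+1<3D))

  base : ∀ {i j} → Congruent D i j → Predicts p (2 * K) D i j
  base {i} {j} c i< j< agree with i + D ≟ K | j + D ≟ K
  ... | yes i≡ | yes j≡ = cong p (trans i≡ (sym j≡))
  ... | no i≢  | no j≢  = trans (p<2K _ i< i≢) (sym (p<2K _ j< j≢))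
  ... | yes i≡ | no j≢  = contradiction (base-mixed i j c j< agree i≡ j≢) λ ()
  ... | no i≢  | yes j≡ = contradiction
    (base-mixed j i (Congruent-sym c) i< (λ t t<D → sym (agree t t<D)) j≡ i≢) λ ()

  -- Descent from windows to their halves

  halves-agree-even : ∀ {L u v} → Agree p (suc (2 * L)) (2 * u) (2 * v) → Agree p (suc L) u v
  halves-agree-even {L} {u} {v} agree t t≤L = trans (sym (p-at-even (u + t) (2+2 u t)))
    (trans (agree (2 * t) (s≤s (*-monoʳ-≤ 2 (s≤s⁻¹ t≤L)))) (p-at-even (v + t) (2+2 v t)))

  ε-agree-even : ∀ {L u v} → Agree p (suc (2 * L)) (2 * u) (2 * v) →
                 ∀ t → t < L → ε (u + t) ≡ ε (v + t)
  ε-agree-even {L} {u} {v} agree t t<L with _ , lt , _ ← 0-1-2* t<L =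
    𝔽₂.+-cancelˡ-≡ (p (u + t)) _ _ (begin
      p (u + t) 𝔽₂.+ ε (u + t)  ≡⟨ p-at-odd (u + t) (2+1+2 u t) ⟨
      p (2 * u + suc (2 * t))   ≡⟨ agree (suc (2 * t)) lt ⟩
      p (2 * v + suc (2 * t))   ≡⟨ p-at-odd (v + t) (2+1+2 v t) ⟩
      p (v + t) 𝔽₂.+ ε (v + t)  ≡⟨ cong (𝔽₂._+ ε (v + t)) (halves-agree-even agree t (m<n⇒m<1+n t<L)) ⟨
      p (u + t) 𝔽₂.+ ε (v + t)  ∎)
    where open ≡-Reasoning

  -- A window with odd start has no entry at 2u, so the pairs 2n, 2n + 1 are complete only from n =
  -- u + 1 on: hence the offset `suc t`.
  ε-agree-odd : ∀ {L u v} → Agree p (suc (2 * L)) (suc (2 * u)) (suc (2 * v)) →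
                ∀ t → t < L → ε (u + suc t) ≡ ε (v + suc t)
  ε-agree-odd {L} {u} {v} agree t t<L with _ , lt₁ , lt₂ ← 0-1-2* t<L =
    𝔽₂.+-cancelˡ-≡ (p (u + suc t)) _ _ (begin
      p (u + suc t) 𝔽₂.+ ε (u + suc t)      ≡⟨ p-at-odd (u + suc t) (1+2+2+2 u t) ⟨
      p (suc (2 * u) + suc (suc (2 * t)))   ≡⟨ agree (suc (suc (2 * t))) lt₂ ⟩
      p (suc (2 * v) + suc (suc (2 * t)))   ≡⟨ p-at-odd (v + suc t) (1+2+2+2 v t) ⟩
      p (v + suc t) 𝔽₂.+ ε (v + suc t)      ≡⟨ cong (𝔽₂._+ ε (v + suc t)) p-agree ⟨
      p (u + suc t) 𝔽₂.+ ε (v + suc t)      ∎)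
    where
    open ≡-Reasoning
    p-agree : p (u + suc t) ≡ p (v + suc t)
    p-agree = trans (sym (p-at-even (u + suc t) (1+2+1+2 u t)))
      (trans (agree (suc (2 * t)) lt₁) (p-at-even (v + suc t) (1+2+1+2 v t)))

  ε-Congruent : ∀ {u v} t → Congruent D u v → ε (u + t) ≡ ε (v + t)
  ε-Congruent {u} {v} t c = subst₂ (λ a b → indicator D a ≡ indicator D b) (+-suc u t) (+-suc v t)
      (indicator-Congruent (suc t) c)

  -- The successor sits at 2(u + L) + 1; its even partner is the last entry of the window, and
  -- congruence mod `D` equates the corrections.
  predict-even : ∀ {L u v} → Congruent D u v → Agree p (suc (2 * L)) (2 * u) (2 * v) →
                 p (2 * u + suc (2 * L)) ≡ p (2 * v + suc (2 * L))
  predict-even {L} {u} {v} c agree = begin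
    p (2 * u + suc (2 * L))    ≡⟨ p-at-odd (u + L) (2+1+2 u L) ⟩
    p (u + L) 𝔽₂.+ ε (u + L)   ≡⟨ cong₂ 𝔽₂._+_ (halves-agree-even agree L ≤-refl) (ε-Congruent L c) ⟩
    p (v + L) 𝔽₂.+ ε (v + L)   ≡⟨ p-at-odd (v + L) (2+1+2 v L) ⟨
    p (2 * v + suc (2 * L))    ∎
    where open ≡-Reasoning

  -- The successor sits at the even index 2(u + L + 1), so it is the successor of the halved window.
  -- The entries at 2(u + t) + 1 determine that window once the equal corrections are cancelled.
  predict-odd : ∀ {X L u v} → Congruent D u v → Predicts p X (suc L) u v →
                Predicts p (2 * X) (suc (2 * L)) (suc (2 * u)) (suc (2 * v))
  predict-odd {X} {L} {u} {v} c predicts u< v< agree = begin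
    p (suc (2 * u) + suc (2 * L))    ≡⟨ p-at-even (u + suc L) (1+2+1+2 u L) ⟩
    p (u + suc L)                    ≡⟨ predicts (bound u u<) (bound v v<) halves-agree ⟩
    p (v + suc L)                    ≡⟨ p-at-even (v + suc L) (1+2+1+2 v L) ⟨
    p (suc (2 * v) + suc (2 * L))    ∎
    where
    open ≡-Reasoning
    bound : ∀ w → suc (2 * w) + suc (2 * L) < 2 * X → w + suc L < X
    bound w w< = *-cancelˡ-< 2 (w + suc L) X (subst (_< 2 * X) (1+2+1+2 w L) w<)
    halves-agree : Agree p (suc L) u v
    halves-agree t t≤L = 𝔽₂.+-cancelʳ-≡ (ε (u + t)) _ _
      (trans (sym (p-at-odd (u + t) (1+2+2 u t)))
      (trans (agree (2 * t) (s≤s (*-monoʳ-≤ 2 (s≤s⁻¹ t≤L))))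
      (trans (p-at-odd (v + t) (1+2+2 v t))
      (cong (p (v + t) 𝔽₂.+_) (sym (ε-Congruent t c))))))

  -- Halving i ≡ j mod `D` leaves only u ≡ v mod `F`. Comparing `ε` at an offset where the number it
  -- tests is a multiple of `F` separates the two classes mod `D`; F ≤ L keeps that offset inside
  -- the window.
  step : ∀ {X L i j} → F ≤ L → (∀ {u v} → Congruent D u v → Predicts p X (suc L) u v) →
         Congruent D i j → Predicts p (2 * X) (suc (2 * L)) i j
  step {X} {L} {i} {j} F≤L predicts c i< j< agree with even-or-odd i | even-or-odd j
  ... | even u | odd v  = contradiction (Congruent-∣ (m∣m*n F) c) (¬Congruent-even-odd u v)
  ... | odd u  | even v = contradiction (Congruent-sym (Congruent-∣ (m∣m*n F) c)) (¬Congruent-even-odd v u)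
  ... | even u | even v with y , y<F , F∣ ← ∃-complement F (suc u) =
    predict-even {L} (Congruent-double (suc y) (Congruent-half-even c) (subst (F ∣_) (sym (+-suc u y)) F∣)
      (subst₂ (λ a b → indicator D a ≡ indicator D b) (sym (+-suc u y)) (sym (+-suc v y))
        (ε-agree-even {L} agree y (<-≤-trans y<F F≤L)))) agree
  ... | odd u  | odd v with y , y<F , F∣ ← ∃-complement F (suc (suc u)) =
    predict-odd c′ (predicts c′) i< j< agree
    where
    c′ : Congruent D u v
    c′ = Congruent-double (suc (suc y)) (Congruent-half-odd c)
      (subst (F ∣_) (sym (trans (+-suc u (suc y)) (cong suc (+-suc u y)))) F∣)
      (subst₂ (λ a b → indicator D a ≡ indicator D b) (sym (+-suc u (suc y))) (sym (+-suc v (suc y)))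
        (ε-agree-odd agree y (<-≤-trans y<F F≤L)))

  L : ℕ → ℕ
  L ℓ = E * 2 ^ ℓ

  L-suc : ∀ ℓ → L (suc ℓ) ≡ 2 * L ℓ
  L-suc ℓ = eq E (2 ^ ℓ)
    where
    eq : ∀ e x → e * (2 * x) ≡ 2 * (e * x)
    eq = solve-∀

  -- Each `step` doubles both the range and M - 1, as `L` does; at ℓ = 0 the order is E + 1 = D.
  predict : ∀ ℓ {i j} → Congruent D i j → Predicts p (2 ^ suc ℓ * K) (suc (L ℓ)) i j
  predict zero {i} {j} c = subst (λ M → Predicts p (2 * K) M i j) (trans (sym suc-E) (cong suc (sym (*-identityʳ E)))) (base c)
  predict (suc ℓ) {i} {j} c =
    subst₂ (λ N M → Predicts p N M i j) (sym (*-assoc 2 (2 ^ suc ℓ) K)) (cong suc (sym (L-suc ℓ)))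
      (step F≤L (predict ℓ) c)
    where
    F≤L : F ≤ L ℓ
    F≤L = ≤-trans F≤E (m≤m*n E (2 ^ ℓ) {{m^n≢0 2 ℓ}})

  -- For i = 2u and j = 2v + 1, agreement expresses ε w, with u + t = 2w, as
  -- a D-periodic function of t, although w ↦ ε w has least period D, that is
  -- 2D in t.
  ¬agree-even-odd : ∀ {L} u v → 2 * D ≤ L → ¬ Agree p (suc (2 * L)) (2 * u) (suc (2 * v))
  ¬agree-even-odd {L} u v 2D≤L agree
    -- Then u + τ = 2w with F | w + 1, so exactly one of w + 1 and w + 1 + F is a multiple of `D`,
    -- and `ε` differs at w and w + F.
    with τ , τ<D , D∣ ← ∃-complement D {{D≢0}} (suc (suc u))
    with 2∣⇒half (∣-trans (m∣m*n F) D∣)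
  ... | zero , ()
  ... | suc w , eq = ε-shift≢ (trans (difference τ w (<-≤-trans τ<D (≤-trans (m≤m+n D _) 2D≤L)) u+τ≡)
    (sym (trans (difference (τ + D) (w + F) τ+D<L u+τ+D≡)
      (cong₂ 𝔽₂._+_ (trans (cong ε (sym (+-assoc u τ D))) (ε-periodic (u + τ)))
                    (trans (cong ε (sym (+-assoc v (suc τ) D))) (ε-periodic (v + suc τ)))))))
    where
    u+τ≡ : u + τ ≡ 2 * w
    u+τ≡ = suc-injective (suc-injective (trans eq (*-suc 2 w)))
    u+τ+D≡ : u + (τ + D) ≡ 2 * (w + F)
    u+τ+D≡ = trans (sym (+-assoc u τ D)) (trans (cong (_+ D) u+τ≡) (2+2 w F))
    τ+D<L : τ + D < L
    τ+D<L = <-≤-trans (+-monoˡ-< D τ<D) (subst (_≤ L) (cong (D +_) (+-identityʳ D)) 2D≤L)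
    F∣ : F ∣ suc w
    F∣ = *-cancelˡ-∣ 2 (subst (D ∣_) eq D∣)
    ε-shift≢ : ε w ≢ ε (w + F)
    ε-shift≢ e with D ∣? suc w
    ... | yes d = ∣2*⇒∤+ {F} d (indicator-≡1 (sym e))
    ... | no ¬d = contradiction (trans e (indicator-∣ (∤2*⇒∣+ F∣ ¬d))) λ ()
    -- Offsets 2t + 2 and 2t + 1 reduce p(2w + 1) to p(2w) plus two corrections; p(2w) = p(w) then
    -- cancels.
    difference : ∀ t w → t < L → u + t ≡ 2 * w → ε w ≡ ε (u + t) 𝔽₂.+ ε (v + suc t)
    difference t w t<L eq with _ , lt₁ , lt₂ ← 0-1-2* t<L = 𝔽₂.+-cancelˡ-≡ (p w) _ _ (begin
      p w 𝔽₂.+ ε w                                    ≡⟨ p-at-odd w (trans (+-suc u t) (cong suc eq)) ⟨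
      p (u + suc t)                                   ≡⟨ p-at-even (u + suc t) (2+2+2 u t) ⟨
      p (2 * u + suc (suc (2 * t)))                   ≡⟨ agree (suc (suc (2 * t))) lt₂ ⟩
      p (suc (2 * v) + suc (suc (2 * t)))             ≡⟨ p-at-odd (v + suc t) (1+2+2+2 v t) ⟩
      p (v + suc t) 𝔽₂.+ ε (v + suc t)                ≡⟨ cong (𝔽₂._+ ε (v + suc t)) (p-at-even (v + suc t) (1+2+1+2 v t)) ⟨
      p (suc (2 * v) + suc (2 * t)) 𝔽₂.+ ε (v + suc t)  ≡⟨ cong (𝔽₂._+ ε (v + suc t)) (agree (suc (2 * t)) lt₁) ⟨
      p (2 * u + suc (2 * t)) 𝔽₂.+ ε (v + suc t)      ≡⟨ cong (𝔽₂._+ ε (v + suc t)) (p-at-odd (u + t) (2+1+2 u t)) ⟩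
      p (u + t) 𝔽₂.+ ε (u + t) 𝔽₂.+ ε (v + suc t)     ≡⟨ cong (λ x → x 𝔽₂.+ ε (u + t) 𝔽₂.+ ε (v + suc t)) (p-at-even w eq) ⟩
      p w 𝔽₂.+ ε (u + t) 𝔽₂.+ ε (v + suc t)           ≡⟨ 𝔽₂.+-assoc (p w) _ _ ⟩
      p w 𝔽₂.+ (ε (u + t) 𝔽₂.+ ε (v + suc t))         ∎)
      where open ≡-Reasoning
    ε-periodic : ∀ n → ε (n + D) ≡ ε n
    ε-periodic n = indicator-periodic D (suc n)

  -- For ℓ ≥ 3 one has 2D ≤ 4E ≤ L(ℓ - 1), so a window covers a full period of `ε`. With equal
  -- parities, an offset where `ε` is 1 in one window, and hence in the other, gives u ≡ v mod `D`.
  predict-all : ∀ ℓ {i j} → 3 ≤ ℓ → Predicts p (2 ^ suc ℓ * K) (suc (L ℓ)) i j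
  predict-all (suc ℓ) {i} {j} (s≤s 2≤ℓ) =
    subst₂ (λ N M → Predicts p N M i j) (sym (*-assoc 2 (2 ^ suc ℓ) K)) (cong suc (sym (L-suc ℓ))) go
    where
    2D≤L : 2 * D ≤ L ℓ
    2D≤L = begin
      2 * D          ≤⟨ *-monoʳ-≤ 2 D≤2E ⟩
      2 * (2 * E)    ≡⟨ eq E ⟩
      E * 2 ^ 2      ≤⟨ *-monoʳ-≤ E (^-monoʳ-≤ 2 2≤ℓ) ⟩
      L ℓ            ∎
      where
      open ≤-Reasoning
      D≤2E : D ≤ 2 * E
      D≤2E = *-monoʳ-≤ 2 F≤E
      eq : ∀ e → 2 * (2 * e) ≡ e * 4
      eq = solve-∀
    D≤L : D ≤ L ℓ
    D≤L = ≤-trans (m≤m+n D _) 2D≤L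
    congruent : ∀ {u v} y → D ∣ suc u + y → ε (u + y) ≡ ε (v + y) → Congruent D u v
    congruent {u} {v} y D∣ eq = suc y , subst (D ∣_) (sym (+-suc u y)) D∣ ,
      subst (D ∣_) (sym (+-suc v y)) (indicator-≡1 (trans (sym eq) (indicator-∣ D∣)))
    go : Predicts p (2 * (2 ^ suc ℓ * K)) (suc (2 * L ℓ)) i j
    go i< j< agree with even-or-odd i | even-or-odd j
    ... | even u | odd v  = contradiction agree (¬agree-even-odd u v 2D≤L)
    ... | odd u  | even v = contradiction (λ t t< → sym (agree t t<)) (¬agree-even-odd v u 2D≤L)
    ... | even u | even v with y , y<D , D∣ ← ∃-complement D {{D≢0}} (suc u) =
      predict-even {L ℓ} {u} {v} (congruent y D∣ (ε-agree-even {L ℓ} {u} {v} agree y (<-≤-trans y<D D≤L))) agree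
    ... | odd u  | odd v with y , y<D , D∣ ← ∃-complement D {{D≢0}} (suc (suc u)) =
      predict-odd {2 ^ suc ℓ * K} {L ℓ} c (predict ℓ c) i< j< agree
      where
      c : Congruent D u v
      c = congruent (suc y) (subst (D ∣_) (sym (+-suc (suc u) y)) D∣)
        (ε-agree-odd {L ℓ} {u} {v} agree y (<-≤-trans y<D D≤L))

  -- Lower bound: equal windows with different successors

  p-scale : ∀ ℓ n → p (n * 2 ^ ℓ) ≡ p n
  p-scale zero n    = cong p (*-identityʳ n)
  p-scale (suc ℓ) n = trans (p-at-even (n * 2 ^ ℓ) (eq n (2 ^ ℓ))) (p-scale ℓ n)
    where
    eq : ∀ n x → n * (2 * x) ≡ 2 * (n * x)
    eq = solve-∀

  -- At ℓ = 0 both indices lie below E + D = K, where `p` vanishes. Doubling preserves the equality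
  -- because a shift by a multiple of `D` leaves `ε` unchanged.
  p-shift : ∀ ℓ t → t < L ℓ → p (t + D * 2 ^ ℓ) ≡ p t
  p-shift zero t t<E = trans (p<K _ t+D<K) (sym (p<K t (<-trans (subst (t <_) (*-identityʳ E) t<E) E<K)))
    where
    t+D<K : t + D * 1 < K
    t+D<K = s≤s⁻¹ (begin-strict
      suc (t + D * 1)   ≡⟨ cong (λ x → suc (t + x)) (*-identityʳ D) ⟩
      suc t + D         <⟨ +-monoˡ-< D (s≤s (subst (t <_) (*-identityʳ E) t<E)) ⟩
      suc E + D         ≡⟨ cong (_+ D) suc-E ⟩
      D + D             ≡⟨ cong (D +_) (+-identityʳ D) ⟨
      2 * D             ≡⟨ suc-K ⟨
      suc K             ∎)
      where open ≤-Reasoning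
  p-shift (suc ℓ) t t<L with even-or-odd t
  ... | even u = trans (p-at-even (u + D * 2 ^ ℓ) (eq u D (2 ^ ℓ))) (trans (p-shift ℓ u u<L) (sym (p-even u)))
    where
    u<L : u < L ℓ
    u<L = *-cancelˡ-< 2 u (L ℓ) (subst (2 * u <_) (L-suc ℓ) t<L)
    eq : ∀ u d x → 2 * u + d * (2 * x) ≡ 2 * (u + d * x)
    eq = solve-∀
  ... | odd u = trans (p-at-odd (u + D * 2 ^ ℓ) (eq u D (2 ^ ℓ)))
    (trans (cong₂ 𝔽₂._+_ (p-shift ℓ u u<L) ε-shift) (sym (p-odd u)))
    where
    u<L : u < L ℓ
    u<L = *-cancelˡ-< 2 u (L ℓ) (<-trans (n<1+n _) (subst (suc (2 * u) <_) (L-suc ℓ) t<L))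
    ε-shift : ε (u + D * 2 ^ ℓ) ≡ ε u
    ε-shift = indicator-cong
      (λ d → ∣m+n∣m⇒∣n (subst (D ∣_) (+-comm (suc u) _) d) (m∣m*n (2 ^ ℓ)))
      (λ d → ∣m∣n⇒∣m+n d (m∣m*n (2 ^ ℓ)))
    eq : ∀ u d x → suc (2 * u) + d * (2 * x) ≡ suc (2 * (u + d * x))
    eq = solve-∀

  L+D2^ℓ : ∀ ℓ → L ℓ + D * 2 ^ ℓ ≡ K * 2 ^ ℓ
  L+D2^ℓ ℓ = trans (sym (*-distribʳ-+ (2 ^ ℓ) E D)) (cong (_* 2 ^ ℓ) (suc-injective
    (trans (cong (_+ D) suc-E) (trans (cong (D +_) (sym (+-identityʳ D))) (sym suc-K)))))

  -- The windows ending just before L and K 2^ℓ = L + D 2^ℓ agree by `p-shift`, while `p-scale`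
  -- turns their successors into p(E) = 0 and p(K) = 1.
  ¬predicts : ∀ ℓ {N} M → M ≤ L ℓ → K * 2 ^ ℓ < N →
              ¬ (∀ i j → Predicts p N M i j)
  ¬predicts ℓ {N} M M≤L K2^ℓ<N predicts = contradiction
    (trans (sym p-L) (trans (trans (cong p (sym i+M≡)) (trans (predicts i (i + D * 2 ^ ℓ) i< j< agree) (cong p j+M≡))) p-L+))
    λ ()
    where
    i : ℕ
    i = L ℓ ∸ M
    i+M≡ : i + M ≡ L ℓ
    i+M≡ = m∸n+n≡m M≤L
    swap : ∀ i q t → i + q + t ≡ i + t + q
    swap = solve-∀
    j+M≡ : i + D * 2 ^ ℓ + M ≡ K * 2 ^ ℓ
    j+M≡ = trans (swap i (D * 2 ^ ℓ) M) (trans (cong (_+ D * 2 ^ ℓ) i+M≡) (L+D2^ℓ ℓ))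
    j< : i + D * 2 ^ ℓ + M < N
    j< = subst (_< N) (sym j+M≡) K2^ℓ<N
    i< : i + M < N
    i< = ≤-<-trans (subst₂ _≤_ (sym i+M≡) (L+D2^ℓ ℓ) (m≤m+n (L ℓ) _)) K2^ℓ<N
    agree : Agree p M i (i + D * 2 ^ ℓ)
    agree t t<M = sym (trans (cong p (swap i (D * 2 ^ ℓ) t))
      (p-shift ℓ (i + t) (subst (i + t <_) i+M≡ (+-monoʳ-< i t<M))))
    p-L : p (L ℓ) ≡ 0ℙ
    p-L = trans (p-scale ℓ E) (p<K E E<K)
    p-L+ : p (K * 2 ^ ℓ) ≡ 1ℙ
    p-L+ = trans (p-scale ℓ K) pK≡1

-- Doubling rules for the pattern sequence

⌊2*n/2⌋≡n : ∀ n → ⌊ 2 * n /2⌋ ≡ n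
⌊2*n/2⌋≡n n = trans (cong ⌊_/2⌋ (cong (n +_) (+-identityʳ n))) (sym (n≡⌊n+n/2⌋ n))

⌊1+2*n/2⌋≡n : ∀ n → ⌊ suc (2 * n) /2⌋ ≡ n
⌊1+2*n/2⌋≡n n = trans (cong (λ x → ⌊ suc x /2⌋) (cong (n +_) (+-identityʳ n))) (sym (n≡⌈n+n/2⌉ n))

module _ (h : ℕ) where

  private
    k F : ℕ
    k = suc (suc h)
    F = 2 ^ h

  pattern-even : ∀ u → pattern-sequence k (2 * u) ≡ pattern-sequence k u
  pattern-even zero = refl
  pattern-even u@(suc _) = trans (pattern-stay k (2 * u) (s≤s z≤n) ∤)
    (cong (pattern-sequence k) (⌊2*n/2⌋≡n u))
    where
    ∤ : ¬ 2 ^ k ∣ suc (2 * u)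
    ∤ d with a , eq ← 2∣⇒half (∣-trans (m∣m*n (2 ^ suc h)) d) = even≢odd a u (sym eq)

  pattern-odd : ∀ u → pattern-sequence k (suc (2 * u)) ≡
                pattern-sequence k u 𝔽₂.+ indicator (2 * F) (suc u)
  pattern-odd u with 2 * F ∣? suc u
  ... | yes d = trans
    (pattern-step k (suc (2 * u)) (s≤s z≤n) (subst (2 ^ k ∣_) (*-suc 2 u) (*-monoʳ-∣ 2 d)))
    (cong (λ n → pattern-sequence k n 𝔽₂.+ 1ℙ) (⌊1+2*n/2⌋≡n u))
  ... | no ¬d = trans
    (pattern-stay k (suc (2 * u)) (s≤s z≤n)
      (λ d → ¬d (*-cancelˡ-∣ 2 (subst (2 ^ k ∣_) (sym (*-suc 2 u)) d))))
    (trans (cong (pattern-sequence k) (⌊1+2*n/2⌋≡n u)) (sym (𝔽₂.+-identityʳ _)))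

-- The ceiling of the logarithm and the resulting complexity

open import Data.Integer.Base using (+_)

⌈log₂/⌉≤⇒ : ∀ N K n .{{_ : NonZero N}} .{{_ : NonZero K}} →
            ⌈log₂ (+ N / K) ⌉ ≤ n → N ≤ 2 ^ n * K
⌈log₂/⌉≤⇒ N@(suc _) K@(suc _) n c≤n
  with ℚᵘ.*≤* le ← Equivalence.to (⌈log₂⌉≤⇔≤2^ (+ N / K) n) c≤n
  = subst (_≤ 2 ^ n * K) (*-identityʳ N) (ℤ.drop‿+≤+ (subst₂ ℤ._≤_ (sym (ℤ.pos-* N 1)) (sym (ℤ.pos-* (2 ^ n) K)) le))

⇒⌈log₂/⌉≤ : ∀ N K n .{{_ : NonZero N}} .{{_ : NonZero K}} →
            N ≤ 2 ^ n * K → ⌈log₂ (+ N / K) ⌉ ≤ n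
⇒⌈log₂/⌉≤ N@(suc _) K@(suc _) n N≤ = Equivalence.from (⌈log₂⌉≤⇔≤2^ (+ N / K) n)
  (ℚᵘ.*≤* (subst₂ ℤ._≤_ (ℤ.pos-* N 1) (ℤ.pos-* (2 ^ n) K) (ℤ.+≤+ (subst (_≤ 2 ^ n * K) (sym (*-identityʳ N)) N≤))))

2^n*K<N : ∀ N K n .{{_ : NonZero N}} .{{_ : NonZero K}} →
          n < ⌈log₂ (+ N / K) ⌉ → 2 ^ n * K < N
2^n*K<N N K n n<c = ≰⇒> λ N≤ → <⇒≱ n<c (⇒⌈log₂/⌉≤ N K n N≤)

theorem2 : (k : ℕ) .{{_ : NonTrivial k}} (N : ℕ) → N ≥ 2 ^ (k + 3) ∸ 7 →
    let ℓ = ⌈log₂ (+ N / (2 ^ k ∸ 1)) ⌉ ∸ 1 in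
    MaximumOrderComplexity (pattern-sequence k) N ((2 ^ (k ∸ 1) ∸ 1) * 2 ^ ℓ + 1)
theorem2 k@(suc (suc h)) N N≥ = complexity ⌈log₂ (+ N / K) ⌉ refl
  where
  open DoublingSequence (2 ^ h) {{m^n≢0 2 h}} (pattern-sequence k) refl (pattern-even h) (pattern-odd h)

  -- As 8 (2^k - 1) + 1 = 2^(k+3) - 7, the assumed bound on `N` says exactly N > 8K, which gives ℓ ≥
  -- 3.
  8K<N : 2 ^ 3 * K < N
  8K<N = ≤-trans (≤-reflexive (sym eq)) N≥
    where
    8* : ∀ n → suc n * 8 ≡ 7 + suc (8 * n)
    8* = solve-∀
    eq : 2 ^ (k + 3) ∸ 7 ≡ suc (8 * K)
    eq = trans (cong (_∸ 7) (trans (^-distribˡ-+-* 2 k 3)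
      (trans (cong (_* 8) (sym suc-K)) (8* K)))) (m+n∸m≡n 7 _)

  N≢0 : NonZero N
  N≢0 = >-nonZero (≤-<-trans z≤n 8K<N)

  K<pred-N : K < pred N
  K<pred-N = s≤s⁻¹ (begin
    suc (suc K)    ≤⟨ s≤s (+-monoˡ-≤ K (≤-<-trans z≤n E<K)) ⟩
    suc (K + K)    ≤⟨ s≤s (+-monoʳ-≤ K (m≤m+n K (6 * K))) ⟩
    suc (8 * K)    ≤⟨ 8K<N ⟩
    N              ≡⟨ suc-pred N {{N≢0}} ⟨
    suc (pred N)   ∎)
    where open ≤-Reasoning

  ¬constant : ¬ (∃[ a ] ConstantUpTo (pattern-sequence k) (pred N) a)
  ¬constant (a , constant) =
    contradiction (trans (constant 0 (≤-<-trans z≤n K<pred-N)) (trans (sym (constant K K<pred-N)) pK≡1)) λ ()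

  -- Abstracting the logarithm as `c` lets `c ∸ 1` reduce once `c` is split; c = 0 would force N ≤
  -- K.
  complexity : ∀ c → ⌈log₂ (+ N / K) ⌉ ≡ c →
               MaximumOrderComplexity (pattern-sequence k) N (E * 2 ^ (c ∸ 1) + 1)
  complexity zero c≡ = contradiction
    (≤-trans (⌈log₂/⌉≤⇒ N K 0 {{N≢0}} (≤-reflexive c≡)) (*-monoˡ-≤ K {1} {8} (s≤s z≤n))) (<⇒≱ 8K<N)
  complexity (suc ℓ) c≡ = subst (MaximumOrderComplexity (pattern-sequence k) N) (+-comm 1 (L ℓ))
    (nonconstant ¬constant (s≤s z≤n)
      (predicts⇒HasRecurrence (pattern-sequence k) λ i j i< j< → predict-all ℓ 3≤ℓ (<-≤-trans i< N≤) (<-≤-trans j< N≤))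
      λ M _ rec → ≰⇒> λ M≤L → ¬predicts ℓ M M≤L <N (HasRecurrence⇒predicts (pattern-sequence k) rec))
    where
    N≤ : N ≤ 2 ^ suc ℓ * K
    N≤ = ⌈log₂/⌉≤⇒ N K (suc ℓ) {{N≢0}} (≤-reflexive c≡)
    <N : K * 2 ^ ℓ < N
    <N = subst (_< N) (*-comm (2 ^ ℓ) K) (2^n*K<N N K ℓ {{N≢0}} (≤-reflexive (sym c≡)))
    3≤ℓ : 3 ≤ ℓ
    3≤ℓ = s≤s⁻¹ (≰⇒> λ c≤3 → <⇒≱ 8K<N (⌈log₂/⌉≤⇒ N K 3 {{N≢0}} (≤-trans (≤-reflexive c≡) c≤3)))
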